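{- The logic $\mathsf{CS4}$ has the finite model property: for every formula $\varphi$, if $\mathsf{CS4}\nvdash\varphi$, then there is a $\mathsf{CS4}$-model $\mathcal M=(W,W_\bot,\preccurlyeq,\sqsubseteq,V)$ with $W$ finite such that $\mathcal M\not\models\varphi$. (Conversely, every theorem of $\mathsf{CS4}$ is valid on all $\mathsf{CS4}$-models.)
   Context: Fix a countably infinite set $\mathbb P$ of propositional variables. Formulas: $\varphi,\psi ::= p\mid\bot\mid(\varphi\wedge\psi)\mid(\varphi\vee\psi)\mid(\varphi\to\psi)\mid\Diamond\varphi\mid\Box\varphi$ with $p\in\mathbb P$; $\neg\varphi:=\varphi\to\bot$. A bi-intuitionistic frame is $\mathcal F=(W,W_\bot,\preccurlyeq,\sqsubseteq)$ where $\preccurlyeq$ and $\sqsubseteq$ are preorders on a set $W$ and $W_\bot\subseteq W$ (the fallible worlds) is upward closed under both $\preccurlyeq$ and $\sqsubseteq$; it is infallible if $W_\bot=\varnothing$. A valuation is a map $V:\mathbb P\to 2^W$ such that each $V(p)$ is upward closed under $\preccurlyeq$ and $W_\bot\subseteq V(p)$; a model is $\mathcal M=(W,W_\bot,\preccurlyeq,\sqsubseteq,V)$. Satisfaction: $(\mathcal M,w)\models p$ iff $w\in V(p)$; $(\mathcal M,w)\models\bot$ iff $w\in W_\bot$; $\wedge,\vee$ pointwise; $(\mathcal M,w)\models\varphi\to\psi$ iff for all $v\succcurlyeq w$, $(\mathcal M,v)\models\varphi$ implies $(\mathcal M,v)\models\psi$; $(\mathcal M,w)\models\Diamond\varphi$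 iff for all $u\succcurlyeq w$ there is $v\sqsupseteq u$ with $(\mathcal M,v)\models\varphi$; $(\mathcal M,w)\models\Box\varphi$ iff for all $u,v$ with $w\preccurlyeq u\sqsubseteq v$, $(\mathcal M,v)\models\varphi$. $\mathcal M\models\varphi$ means $(\mathcal M,w)\models\varphi$ for all $w\in W\setminus W_\bot$. For $R\subseteq W\times W$ (relative to $\preccurlyeq$): $R$ is backward confluent if $wRv\preccurlyeq v'$ implies there is $w'$ with $w\preccurlyeq w'Rv'$. A $\mathsf{CS4}$-frame is a bi-intuitionistic frame in which $\sqsubseteq$ is backward confluent; a $\mathsf{CS4}$-model is a model on such a frame. $\mathsf{CS4}$ is the least set of formulas containing all intuitionistic propositional tautologies (in this language) and all instances of $\Box(\varphi\to\psi)\to(\Box\varphi\to\Box\psi)$, $\Box(\varphi\to\psi)\to(\Diamond\varphi\to\Diamond\psi)$, $\Box\varphi\to\varphi$, $\varphi\to\Diamond\varphi$, $\Box\varphi\to\Box\Box\varphi$, $\Diamond\Diamond\varphi\to\Diamond\varphi$, closed under modus ponens and necessitation (from $\varphi$ infer $\Box\varphi$). -}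

module Defs where

open import Data.Fin using (Fin)
open import Data.Nat using (ℕ)
open import Data.Product using (∃; _×_)
open import Data.Sum using (_⊎_)
open import Function.Bundles using (_↔_)
open import Level using (0ℓ)
open import Relation.Binary using (Rel; IsPreorder; _Respects_)
open import Relation.Binary.PropositionalEquality using (_≡_)
open import Relation.Nullary using (¬_)
open import Relation.Unary using (Pred; _⊆_)

infixr 7 _∧_
infixr 6 _∨_
infixr 5 _⇒_
infix  8 ◇_ □_

-- The countably infinite set of propositional variables is ℕ.
data Formula : Set where
  var         : ℕ → Formula
  ⊥′          : Formula
  _∧_ _∨_ _⇒_ : Formula → Formula → Formula
  ◇_ □_       : Formula → Formula

infix 2 IPC⊢_ CS4⊢_

-- Intuitionistic propositional tautologies in the modal language, in Hilbert
-- style: no axiom mentions ◇ or □, so modal formulas behave as atoms.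
data IPC⊢_ : Formula → Set where
  K    : ∀ {φ ψ} → IPC⊢ φ ⇒ (ψ ⇒ φ)
  S    : ∀ {φ ψ χ} → IPC⊢ (φ ⇒ (ψ ⇒ χ)) ⇒ ((φ ⇒ ψ) ⇒ (φ ⇒ χ))
  ∧-I  : ∀ {φ ψ} → IPC⊢ φ ⇒ (ψ ⇒ (φ ∧ ψ))
  ∧-E₁ : ∀ {φ ψ} → IPC⊢ (φ ∧ ψ) ⇒ φ
  ∧-E₂ : ∀ {φ ψ} → IPC⊢ (φ ∧ ψ) ⇒ ψ
  ∨-I₁ : ∀ {φ ψ} → IPC⊢ φ ⇒ (φ ∨ ψ)
  ∨-I₂ : ∀ {φ ψ} → IPC⊢ ψ ⇒ (φ ∨ ψ)
  ∨-E  : ∀ {φ ψ χ} → IPC⊢ (φ ⇒ χ) ⇒ ((ψ ⇒ χ) ⇒ ((φ ∨ ψ) ⇒ χ))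
  ⊥-E  : ∀ {φ} → IPC⊢ ⊥′ ⇒ φ
  MP   : ∀ {φ ψ} → IPC⊢ φ ⇒ ψ → IPC⊢ φ → IPC⊢ ψ

data CS4⊢_ : Formula → Set where
  taut : ∀ {φ} → IPC⊢ φ → CS4⊢ φ
  K□   : ∀ {φ ψ} → CS4⊢ □ (φ ⇒ ψ) ⇒ (□ φ ⇒ □ ψ)
  K◇   : ∀ {φ ψ} → CS4⊢ □ (φ ⇒ ψ) ⇒ (◇ φ ⇒ ◇ ψ)
  T□   : ∀ {φ} → CS4⊢ □ φ ⇒ φ
  T◇   : ∀ {φ} → CS4⊢ φ ⇒ ◇ φ
  4□   : ∀ {φ} → CS4⊢ □ φ ⇒ □ □ φ
  4◇   : ∀ {φ} → CS4⊢ ◇ ◇ φ ⇒ ◇ φ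
  MP   : ∀ {φ ψ} → CS4⊢ φ ⇒ ψ → CS4⊢ φ → CS4⊢ ψ
  Nec  : ∀ {φ} → CS4⊢ φ → CS4⊢ □ φ

-- P Respects R says that P is upward closed under R.
record Frame : Set₁ where
  infix 4 _≼_ _⊑_
  field
    W            : Set
    W⊥           : Pred W 0ℓ
    _≼_ _⊑_      : Rel W 0ℓ
    ≼-isPreorder : IsPreorder _≡_ _≼_
    ⊑-isPreorder : IsPreorder _≡_ _⊑_
    W⊥-≼-closed  : W⊥ Respects _≼_
    W⊥-⊑-closed  : W⊥ Respects _⊑_

record Model : Set₁ where
  field
    frame : Frame
  open Frame frame public
  field
    V          : ℕ → Pred W 0ℓ
    V-≼-closed : ∀ p → V p Respects _≼_
    W⊥⊆V       : ∀ p → W⊥ ⊆ V p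

infix 3 ⟨_,_⟩⊨_ _⊨_

⟨_,_⟩⊨_ : (M : Model) → Model.W M → Formula → Set
⟨ M , w ⟩⊨ var p   = Model.V M p w
⟨ M , w ⟩⊨ ⊥′      = Model.W⊥ M w
⟨ M , w ⟩⊨ (φ ∧ ψ) = (⟨ M , w ⟩⊨ φ) × (⟨ M , w ⟩⊨ ψ)
⟨ M , w ⟩⊨ (φ ∨ ψ) = (⟨ M , w ⟩⊨ φ) ⊎ (⟨ M , w ⟩⊨ ψ)
⟨ M , w ⟩⊨ (φ ⇒ ψ) = let open Model M in
  ∀ v → w ≼ v → ⟨ M , v ⟩⊨ φ → ⟨ M , v ⟩⊨ ψ
⟨ M , w ⟩⊨ ◇ φ     = let open Model M in
  ∀ u → w ≼ u → ∃ λ v → (u ⊑ v) × (⟨ M , v ⟩⊨ φ)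
⟨ M , w ⟩⊨ □ φ     = let open Model M in
  ∀ u v → w ≼ u → u ⊑ v → ⟨ M , v ⟩⊨ φ

_⊨_ : Model → Formula → Set
M ⊨ φ = ∀ w → ¬ Model.W⊥ M w → ⟨ M , w ⟩⊨ φ

BackwardConfluent : {W : Set} → Rel W 0ℓ → Rel W 0ℓ → Set
BackwardConfluent _≼_ R =
  ∀ {w v v′} → R w v → v ≼ v′ → ∃ λ w′ → (w ≼ w′) × R w′ v′

IsCS4Frame : Frame → Set
IsCS4Frame F = BackwardConfluent _≼_ _⊑_
  where open Frame F

record CS4Model : Set₁ where
  field
    model      : Model
    isCS4Frame : IsCS4Frame (Model.frame model)
  open Model model public

Finite : Set → Set
Finite A = ∃ λ n → A ↔ Fin n

{-# OPTIONS --safe #-}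

-- Completeness is witnessed by a finite canonical model over the list Σ of
-- subformulas of φ (and ⊥).  A world is a prime Σ-theory Γ together with at most
-- one promise: a formula ψ with Γ ⊬ ◇ψ, which has to stay false along ⊑.  The
-- order ≼ is inclusion of theories and ignores promises; ⊑ preserves the boxed
-- formulas of Γ and the promise.  Dropping the promise of a world therefore gives
-- backward confluence, and adding the promise ψ refutes ◇ψ.
--
-- Primality of a subset of Σ is not decidable a priori, so the carrier consists of
-- all pairs (subset, promise), and pairs that are not worlds are isolated points.
-- Since ¬ (M ⊨ φ) is a negation, the finitely many instances of excluded middle
-- needed for the Lindenbaum construction are available when proving it.
module Submission where

open import Data.Fin using (Fin; zero; suc)
open import Data.Fin.Properties using (1↔⊤; 2↔Bool; *↔×; any?; sequence)
open import Data.Fin.Subset using (Subset; ⁅_⁆; _∈_; _⊆_; _⊃_; _∪_; _∩_) renaming (⊥ to ∅; ⊤ to full)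
open import Data.Fin.Subset.Induction using (⊃-wellFounded; Acc; acc)
open import Data.Fin.Subset.Properties using (_∈?_; ∉⊥; ∈⊤; ⊆⊤; x∈⁅x⁆; x∈⁅y⁆⇒x≡y; p⊆p∪q; q⊆p∪q; x∈p∪q⁻; x∈p∩q⁺; x∈p∩q⁻)
open import Data.List using (List; []; _∷_; _++_; lookup)
open import Data.List.Membership.Propositional using () renaming (_∈_ to _∈ₗ_)
open import Data.List.Relation.Unary.All using (All; _∷_; head; tabulate)
open import Data.List.Relation.Unary.All.Properties using (++⁻ˡ; ++⁻ʳ)
open import Data.List.Relation.Unary.Any using (here; there; index)
open import Data.List.Relation.Unary.Any.Properties using (lookup-index)
open import Data.Nat using (ℕ; zero; suc)
open import Data.Product using (∃; _×_; _,_; proj₁; proj₂; Σ-syntax; uncurry)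
open import Data.Product.Function.NonDependent.Propositional using (_×-↔_)
open import Data.Sum as Sum using (_⊎_; inj₁; inj₂; [_,_]′)
import Data.Vec as Vec
open import Data.Vec using ([]; _∷_)
open import Data.Vec.Properties using (lookup∘tabulate; lookup⇒[]=; []=⇒lookup)
open import Effect.Monad using (RawMonad)
open import Function using (_∘_; id)
open import Function.Bundles using (mk↔ₛ′; Inverse)
open import Function.Properties.Inverse using (↔-refl; ↔-sym; ↔-trans)
open import Level using (0ℓ)
open import Relation.Binary using (Rel; Transitive; IsPreorder)
open import Relation.Binary.Construct.Closure.Reflexive using (ReflClosure; refl; [_])
open import Relation.Binary.Construct.Closure.Reflexive.Properties using (isPreorder)
open import Relation.Binary.PropositionalEquality using (_≡_; refl; sym; trans; subst)
open import Relation.Nullary using (¬_; Dec; yes; no; does; contradiction)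
open import Relation.Nullary.Decidable using (¬?; _×-dec_; dec-true; ¬¬-excluded-middle)
open import Relation.Nullary.Negation using (¬¬-Monad)
import Relation.Unary as U
open import Relation.Unary using (Pred; Decidable)
open import Defs

-- Soundness

module Soundness (M : CS4Model) where
  open CS4Model M

  private
    module ≼ = IsPreorder ≼-isPreorder
    module ⊑ = IsPreorder ⊑-isPreorder

  ⊨-mono : ∀ χ {w v} → w ≼ v → ⟨ model , w ⟩⊨ χ → ⟨ model , v ⟩⊨ χ
  ⊨-mono (var p) w≼v h         = V-≼-closed p w≼v h
  ⊨-mono ⊥′      w≼v h         = W⊥-≼-closed w≼v h
  ⊨-mono (A ∧ B) w≼v (a , b)   = ⊨-mono A w≼v a , ⊨-mono B w≼v b
  ⊨-mono (A ∨ B) w≼v (inj₁ a)  = inj₁ (⊨-mono A w≼v a)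
  ⊨-mono (A ∨ B) w≼v (inj₂ b)  = inj₂ (⊨-mono B w≼v b)
  ⊨-mono (A ⇒ B) w≼v h u v≼u   = h u (≼.trans w≼v v≼u)
  ⊨-mono (◇ A)   w≼v h u v≼u   = h u (≼.trans w≼v v≼u)
  ⊨-mono (□ A)   w≼v h u t v≼u = h u t (≼.trans w≼v v≼u)

  -- Justifies ex falso: fallibility spreads along both orders, which settles `⇒` and `□`, while `◇`
  -- is witnessed by reflexivity of `⊑`.
  fallible⇒⊨ : ∀ χ {w} → W⊥ w → ⟨ model , w ⟩⊨ χ
  fallible⇒⊨ (var p) f             = W⊥⊆V p f
  fallible⇒⊨ ⊥′      f             = f
  fallible⇒⊨ (A ∧ B) f             = fallible⇒⊨ A f , fallible⇒⊨ B f
  fallible⇒⊨ (A ∨ B) f             = inj₁ (fallible⇒⊨ A f)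
  fallible⇒⊨ (A ⇒ B) f v w≼v _     = fallible⇒⊨ B (W⊥-≼-closed w≼v f)
  fallible⇒⊨ (◇ A)   f u w≼u       = u , ⊑.refl , fallible⇒⊨ A (W⊥-≼-closed w≼u f)
  fallible⇒⊨ (□ A)   f u v w≼u u⊑v = fallible⇒⊨ A (W⊥-⊑-closed u⊑v (W⊥-≼-closed w≼u f))

  IPC-sound : ∀ {χ} → IPC⊢ χ → ∀ w → ⟨ model , w ⟩⊨ χ
  IPC-sound (K {φ}) w _ _ a u v≼u _ = ⊨-mono φ v≼u a
  IPC-sound S w _ _ f _ v≼u g t u≼t a =
    f t (≼.trans v≼u u≼t) a t ≼.refl (g t u≼t a)
  IPC-sound (∧-I {φ}) w _ _ a _ v≼u b = ⊨-mono φ v≼u a , b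
  IPC-sound ∧-E₁ w _ _ = proj₁
  IPC-sound ∧-E₂ w _ _ = proj₂
  IPC-sound ∨-I₁ w _ _ = inj₁
  IPC-sound ∨-I₂ w _ _ = inj₂
  IPC-sound ∨-E w _ _ f _ v≼u g t u≼t =
    [ f t (≼.trans v≼u u≼t) , g t u≼t ]′
  IPC-sound (⊥-E {φ}) w _ _ = fallible⇒⊨ φ
  IPC-sound (MP d e) w = IPC-sound d w w ≼.refl (IPC-sound e w)

  CS4-sound : ∀ {χ} → CS4⊢ χ → ∀ w → ⟨ model , w ⟩⊨ χ
  CS4-sound (taut d) = IPC-sound d
  CS4-sound K□ w _ _ f _ v≼u g s t u≼s s⊑t =
    f s t (≼.trans v≼u u≼s) s⊑t t ≼.refl (g s t u≼s s⊑t)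
  CS4-sound K◇ w _ _ f _ v≼u g s u≼s =
    let t , s⊑t , a = g s u≼s
    in  t , s⊑t , f s t (≼.trans v≼u u≼s) s⊑t t ≼.refl a
  CS4-sound T□ w v _ f = f v v ≼.refl ⊑.refl
  CS4-sound (T◇ {φ}) w _ _ a u v≼u = u , ⊑.refl , ⊨-mono φ v≼u a
  CS4-sound 4□ w _ _ f _ _ v≼s s⊑t _ u t≼r r⊑u =
    -- Backward confluence turns the path `s ⊑ t ≼ r ⊑ u` into `s ≼ s′ ⊑ r ⊑ u`, so transitivity
    -- brings `u` within reach of a single `□`.
    let s′ , s≼s′ , s′⊑r = isCS4Frame s⊑t t≼r
    in  f s′ u (≼.trans v≼s s≼s′) (⊑.trans s′⊑r r⊑u)
  CS4-sound 4◇ w _ _ f u v≼u =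
    let s , u⊑s , g = f u v≼u
        t , s⊑t , a = g s ≼.refl
    in  t , ⊑.trans u⊑s s⊑t , a
  CS4-sound (MP d e) w = CS4-sound d w w ≼.refl (CS4-sound e w)
  CS4-sound (Nec d) w _ v _ _ = CS4-sound d v

-- Local derivability

Context : Set₁
Context = Pred Formula 0ℓ

infix 2 _⊢_

-- Necessitation enters only through `thm`, never below a hypothesis; this is what makes the
-- deduction theorem hold.
data _⊢_ (Γ : Context) : Formula → Set where
  hyp : ∀ {χ} → Γ χ → Γ ⊢ χ
  thm : ∀ {χ} → CS4⊢ χ → Γ ⊢ χ
  mp  : ∀ {χ ψ} → Γ ⊢ χ ⇒ ψ → Γ ⊢ χ → Γ ⊢ ψ

ax : ∀ {Γ χ} → IPC⊢ χ → Γ ⊢ χ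
ax = thm ∘ taut

weaken : ∀ {Γ Δ : Context} → Γ U.⊆ Δ → ∀ {χ} → Γ ⊢ χ → Δ ⊢ χ
weaken Γ⊆Δ (hyp h)  = hyp (Γ⊆Δ h)
weaken Γ⊆Δ (thm t)  = thm t
weaken Γ⊆Δ (mp d e) = mp (weaken Γ⊆Δ d) (weaken Γ⊆Δ e)

deduction : ∀ {Γ A χ} → Γ U.∪ U.｛ A ｝ ⊢ χ → Γ ⊢ A ⇒ χ
deduction (hyp (inj₁ h))            = mp (ax K) (hyp h)
deduction {A = A} (hyp (inj₂ refl)) = mp (mp (ax S) (ax K)) (ax (K {ψ = A}))
deduction (thm t)                   = mp (ax K) (thm t)
deduction (mp d e)                  = mp (mp (ax S) (deduction d)) (deduction e)

⊢-closed : ∀ {Γ : Context} → U.Empty Γ → ∀ {χ} → Γ ⊢ χ → CS4⊢ χ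
⊢-closed ∄ (hyp h)  = contradiction h (∄ _)
⊢-closed ∄ (thm t)  = t
⊢-closed ∄ (mp d e) = MP (⊢-closed ∄ d) (⊢-closed ∄ e)

-- ⊥ is included because fallibility, too, is preserved by ⊑.
data Stable : Formula → Set where
  □-stable : ∀ {A} → Stable (□ A)
  ⊥-stable : Stable ⊥′

stable? : Decidable Stable
stable? (var _) = no λ ()
stable? ⊥′      = yes ⊥-stable
stable? (_ ∧ _) = no λ ()
stable? (_ ∨ _) = no λ ()
stable? (_ ⇒ _) = no λ ()
stable? (◇ _)   = no λ ()
stable? (□ _)   = yes □-stable

stable⇒□ : ∀ {χ} → Stable χ → CS4⊢ χ ⇒ □ χ
stable⇒□ □-stable = 4□
stable⇒□ ⊥-stable = taut ⊥-E

-- Induction on the derivation: stable hypotheses imply their own boxes, theorems are necessitated,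
-- and `K□` carries the box through modus ponens.
⊢-nec : ∀ {Γ : Context} → Γ U.⊆ Stable → ∀ {χ} → Γ ⊢ χ → Γ ⊢ □ χ
⊢-nec st (hyp h)  = mp (thm (stable⇒□ (st h))) (hyp h)
⊢-nec st (thm t)  = thm (Nec t)
⊢-nec st (mp d e) = mp (mp (thm K□) (⊢-nec st d)) (⊢-nec st e)

-- Finite types

Subset-finite : ∀ n → Finite (Subset n)
Subset-finite zero    = 1 , ↔-sym (↔-trans 1↔⊤ (mk↔ₛ′ (λ _ → []) _ (λ { [] → refl }) λ _ → refl))
Subset-finite (suc n) = _ , ↔-trans uncons (↔-trans (↔-sym 2↔Bool ×-↔ proj₂ (Subset-finite n)) (↔-sym *↔×))
  where
  uncons = mk↔ₛ′ (λ p → Vec.head p , Vec.tail p) (uncurry _∷_) (λ _ → refl) λ { (_ ∷ _) → refl }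

×-finite : ∀ {A n} → Finite A → Finite (A × Fin n)
×-finite (_ , A↔Fin) = _ , ↔-trans (A↔Fin ×-↔ ↔-refl) (↔-sym *↔×)

-- Double negation is an applicative functor, so it commutes with conjunctions over `Fin`; the
-- bijection transports this to `A`.
¬¬-finite-∀ : ∀ {A : Set} {P : Pred A 0ℓ} → Finite A → (∀ x → ¬ ¬ P x) → ¬ ¬ (∀ x → P x)
¬¬-finite-∀ {P = P} (_ , A↔Fin) ∀¬¬P ¬∀P =
  sequence (RawMonad.rawApplicative ¬¬-Monad) (∀¬¬P ∘ from) λ ∀P →
    ¬∀P λ x → subst P (strictlyInverseʳ x) (∀P (to x))
  where open Inverse A↔Fin

comprehension : ∀ {n} {P : Pred (Fin n) 0ℓ} → Decidable P →
                Σ[ p ∈ Subset n ] (∀ {i} → i ∈ p → P i) × (∀ {i} → P i → i ∈ p)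
comprehension {P = P} P? = Vec.tabulate (does ∘ P?) , ∈⇒P , P⇒∈
  where
  ∈⇒P : ∀ {i} → i ∈ Vec.tabulate (does ∘ P?) → P i
  ∈⇒P {i} i∈p with P? i | trans (sym (lookup∘tabulate (does ∘ P?) i)) ([]=⇒lookup i∈p)
  ... | yes Pi | _  = Pi
  ... | no _   | ()

  P⇒∈ : ∀ {i} → P i → i ∈ Vec.tabulate (does ∘ P?)
  P⇒∈ {i} Pi = lookup⇒[]= i _ (trans (lookup∘tabulate (does ∘ P?) i) (dec-true (P? i) Pi))

-- Indices are added one at a time while `P` survives; strict inclusion of subsets is well-founded
-- upwards.
maximal-above : ∀ {n} {P : Pred (Subset n) 0ℓ} → Decidable P → ∀ p → P p →
                Σ[ q ∈ Subset n ] p ⊆ q × P q × (∀ i → i ∈ q ⊎ ¬ P (q ∪ ⁅ i ⁆))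
maximal-above {n} {P} P? p = go p (⊃-wellFounded p)
  where
  go : ∀ p → Acc _⊃_ p → P p → Σ[ q ∈ Subset n ] p ⊆ q × P q × (∀ i → i ∈ q ⊎ ¬ P (q ∪ ⁅ i ⁆))
  go p (acc rec) Pp with any? (λ i → ¬? (i ∈? p) ×-dec P? (p ∪ ⁅ i ⁆))
  ... | yes (i , i∉p , Pp∪i) =
    let q , p∪i⊆q , Pq , max =
          go (p ∪ ⁅ i ⁆) (rec (p⊆p∪q _ , i , q⊆p∪q p _ (x∈⁅x⁆ i) , i∉p)) Pp∪i
    in  q , p∪i⊆q ∘ p⊆p∪q _ , Pq , max
  ... | no ∄i = p , id , Pp , max
    where
    max : ∀ i → i ∈ p ⊎ ¬ P (p ∪ ⁅ i ⁆)
    max i with i ∈? p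
    ... | yes i∈p = inj₁ i∈p
    ... | no  i∉p = inj₂ λ Pp∪i → ∄i (i , i∉p , Pp∪i)

-- The canonical model over an indexed family of formulas

Listed : ∀ {n} → (Fin n → Formula) → Pred Formula 0ℓ
Listed F χ = ∃ λ i → F i ≡ χ

-- Splitting off the head makes `subformulas χ` a cons cell even for an unknown `χ`, so `head` can
-- extract that `χ` itself is listed.
subformulas properSubformulas : Formula → List Formula
subformulas χ = χ ∷ properSubformulas χ
properSubformulas (var _) = []
properSubformulas ⊥′      = []
properSubformulas (A ∧ B) = subformulas A ++ subformulas B
properSubformulas (A ∨ B) = subformulas A ++ subformulas B
properSubformulas (A ⇒ B) = subformulas A ++ subformulas B
properSubformulas (◇ A)   = subformulas A
properSubformulas (□ A)   = subformulas A

module Canonical {n : ℕ} (F : Fin n → Formula) (⊥-listed : Listed F ⊥′) where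

  ⟦_⟧ : Subset n → Context
  ⟦ Γ ⟧ χ = ∃ λ i → i ∈ Γ × F i ≡ χ

  ∈⇒⊢ : ∀ {Γ i} → i ∈ Γ → ⟦ Γ ⟧ ⊢ F i
  ∈⇒⊢ i∈Γ = hyp (_ , i∈Γ , refl)

  ⊆⇒⊢ : ∀ {Γ Δ} → Γ ⊆ Δ → ∀ {χ} → ⟦ Γ ⟧ ⊢ χ → ⟦ Δ ⟧ ⊢ χ
  ⊆⇒⊢ Γ⊆Δ = weaken λ (i , i∈Γ , eq) → i , Γ⊆Δ i∈Γ , eq

  ∪-deduction : ∀ Γ i {χ} → ⟦ Γ ∪ ⁅ i ⁆ ⟧ ⊢ χ → ⟦ Γ ⟧ ⊢ F i ⇒ χ
  ∪-deduction Γ i = deduction ∘ weaken split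
    where
    split : ⟦ Γ ∪ ⁅ i ⁆ ⟧ U.⊆ ⟦ Γ ⟧ U.∪ U.｛ F i ｝
    split (j , j∈ , eq) with x∈p∪q⁻ Γ ⁅ i ⁆ j∈
    ... | inj₁ j∈Γ = inj₁ (j , j∈Γ , eq)
    ... | inj₂ j∈i with refl ← x∈⁅y⁆⇒x≡y i j∈i = inj₂ eq

  stables : Subset n
  stables = proj₁ (comprehension (stable? ∘ F))

  ∈stables⁻ : ∀ {i} → i ∈ stables → Stable (F i)
  ∈stables⁻ = proj₁ (proj₂ (comprehension (stable? ∘ F)))

  ∈stables⁺ : ∀ {i} → Stable (F i) → i ∈ stables
  ∈stables⁺ = proj₂ (proj₂ (comprehension (stable? ∘ F)))

  ∩stables-nec : ∀ Γ {χ} → ⟦ Γ ∩ stables ⟧ ⊢ χ → ⟦ Γ ⟧ ⊢ □ χ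
  ∩stables-nec Γ = ⊆⇒⊢ (proj₁ ∘ x∈p∩q⁻ Γ stables) ∘ ⊢-nec
    λ { (i , i∈ , refl) → ∈stables⁻ (proj₂ (x∈p∩q⁻ Γ stables i∈)) }

  -- Prime theories and the Lindenbaum lemma.

  record Prime (Γ : Subset n) : Set where
    field
      closed : ∀ {i} → ⟦ Γ ⟧ ⊢ F i → i ∈ Γ
      prime  : ∀ {i j} → ⟦ Γ ⟧ ⊢ F i ∨ F j → i ∈ Γ ⊎ j ∈ Γ

  open Prime

  prime-∨ : ∀ {Γ A B} → Listed F A → Listed F B → Prime Γ → ⟦ Γ ⟧ ⊢ A ∨ B → (⟦ Γ ⟧ ⊢ A) ⊎ (⟦ Γ ⟧ ⊢ B)
  prime-∨ (_ , refl) (_ , refl) Γ-prime ⊢A∨B = Sum.map ∈⇒⊢ ∈⇒⊢ (prime Γ-prime ⊢A∨B)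

  -- Being listed, `χ` belongs to the closed theory `Γ` as a member, hence to its stable part.
  stable-transfer : ∀ {Γ Δ χ} → Listed F χ → Stable χ → Prime Γ → Γ ∩ stables ⊆ Δ → ⟦ Γ ⟧ ⊢ χ → ⟦ Δ ⟧ ⊢ χ
  stable-transfer (_ , refl) st Γ-prime ⊆Δ ⊢χ = ∈⇒⊢ (⊆Δ (x∈p∩q⁺ (closed Γ-prime ⊢χ , ∈stables⁺ st)))

  -- The inconsistent theory yields fallible worlds; it serves as `◇`-successor when the promise is
  -- void.
  full-prime : Prime full
  full-prime = record { closed = λ _ → ∈⊤ ; prime = λ _ → inj₁ ∈⊤ }

  full-⊢ : ∀ {χ} → ⟦ full ⟧ ⊢ χ
  full-⊢ = mp (ax ⊥-E) (subst (⟦ full ⟧ ⊢_) (proj₂ ⊥-listed) (∈⇒⊢ ∈⊤))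

  -- A maximal set not deriving `θ` is prime, since every index outside it yields an implication
  -- into `θ`. The formula `θ` may be unlisted, as happens for `◇ F i`.
  lindenbaum : ∀ {θ} → (∀ Γ → Dec (⟦ Γ ⟧ ⊢ θ)) → ∀ Γ → ¬ (⟦ Γ ⟧ ⊢ θ) →
               Σ[ Δ ∈ Subset n ] Γ ⊆ Δ × Prime Δ × ¬ (⟦ Δ ⟧ ⊢ θ)
  lindenbaum {θ} ⊢θ? Γ Γ⊬θ with maximal-above (λ Δ → ¬? (⊢θ? Δ)) Γ Γ⊬θ
  ... | Δ , Γ⊆Δ , Δ⊬θ , max = Δ , Γ⊆Δ , record { closed = Δ-closed ; prime = Δ-prime } , Δ⊬θ
    where
    ∈-or-refutes : ∀ i → i ∈ Δ ⊎ (⟦ Δ ⟧ ⊢ F i ⇒ θ)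
    ∈-or-refutes i with max i
    ... | inj₁ i∈Δ  = inj₁ i∈Δ
    -- Maximality gives only a doubly negated derivation; decidability recovers the derivation
    -- itself.
    ... | inj₂ ¬¬⊢θ with ⊢θ? (Δ ∪ ⁅ i ⁆)
    ...   | yes ⊢θ = inj₂ (∪-deduction Δ i ⊢θ)
    ...   | no  ⊬θ = contradiction ⊬θ ¬¬⊢θ

    Δ-closed : ∀ {i} → ⟦ Δ ⟧ ⊢ F i → i ∈ Δ
    Δ-closed {i} ⊢Fi with ∈-or-refutes i
    ... | inj₁ i∈Δ   = i∈Δ
    ... | inj₂ ⊢Fi⇒θ = contradiction (mp ⊢Fi⇒θ ⊢Fi) Δ⊬θ

    Δ-prime : ∀ {i j} → ⟦ Δ ⟧ ⊢ F i ∨ F j → i ∈ Δ ⊎ j ∈ Δ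
    Δ-prime {i} {j} ⊢Fi∨Fj with ∈-or-refutes i | ∈-or-refutes j
    ... | inj₁ i∈Δ   | _          = inj₁ i∈Δ
    ... | inj₂ _     | inj₁ j∈Δ   = inj₂ j∈Δ
    ... | inj₂ ⊢Fi⇒θ | inj₂ ⊢Fj⇒θ =
      contradiction (mp (mp (mp (ax ∨-E) ⊢Fi⇒θ) ⊢Fj⇒θ) ⊢Fi∨Fj) Δ⊬θ

  -- Worlds and the finite canonical model.

  -- The promise zero is void; suc i promises that F i fails along ⊑.
  W : Set
  W = Subset n × Fin (suc n)

  Keeps : Subset n → Fin (suc n) → Set
  Keeps Γ d = ∀ {i} → d ≡ suc i → ¬ (⟦ Γ ⟧ ⊢ ◇ F i)

  World : Pred W 0ℓ
  World (Γ , d) = Prime Γ × Keeps Γ d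

  _≼₀_ _⊑₀_ _≼_ _⊑_ : Rel W 0ℓ
  x@(Γ , _) ≼₀ y@(Δ , _) = World x × World y × Γ ⊆ Δ
  x@(Γ , d) ⊑₀ y@(Δ , e) = World x × World y × Γ ∩ stables ⊆ Δ × (∀ {i} → d ≡ suc i → e ≡ suc i)
  _≼_ = ReflClosure _≼₀_
  _⊑_ = ReflClosure _⊑₀_

  ≼₀-trans : Transitive _≼₀_
  ≼₀-trans (x , _ , Γ⊆Δ) (_ , z , Δ⊆Θ) = x , z , Δ⊆Θ ∘ Γ⊆Δ

  ⊑₀-trans : Transitive _⊑₀_
  ⊑₀-trans {Γ , _} (x , _ , ⊆Δ , d) (_ , z , ⊆Θ , e) =
    x , z , (λ i∈ → ⊆Θ (x∈p∩q⁺ (⊆Δ i∈ , proj₂ (x∈p∩q⁻ Γ stables i∈)))) , e ∘ d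

  ⊑-backwardConfluent : BackwardConfluent _≼_ _⊑_
  ⊑-backwardConfluent x⊑y refl = _ , refl , x⊑y
  ⊑-backwardConfluent refl [ y≼z ] = _ , [ y≼z ] , refl
  ⊑-backwardConfluent {Γ , d} [ x@(Γ-prime , _) , _ , ⊆Δ , _ ] [ _ , z , Δ⊆Θ ] =
    -- The void promise binds no successor, so only the inclusion of the stable part of `Γ` in the
    -- larger theory remains.
    (Γ , zero) , [ x , x₀ , id ] , [ x₀ , z , Δ⊆Θ ∘ ⊆Δ , (λ ()) ]
    where
    x₀ : World (Γ , zero)
    x₀ = Γ-prime , λ ()

  frame : Frame
  frame = record
    { W            = W
    ; W⊥           = λ x → World x × (⟦ proj₁ x ⟧ ⊢ ⊥′)
    ; _≼_          = _≼_
    ; _⊑_          = _⊑_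
    ; ≼-isPreorder = isPreorder ≼₀-trans
    ; ⊑-isPreorder = isPreorder ⊑₀-trans
    ; W⊥-≼-closed  = λ where
        refl            f        → f
        [ _ , y , Γ⊆Δ ] (_ , ⊢⊥) → y , ⊆⇒⊢ Γ⊆Δ ⊢⊥
    ; W⊥-⊑-closed  = λ where
        refl               f        → f
        [ _ , y , ⊆Δ , _ ] (x , ⊢⊥) → y , stable-transfer ⊥-listed ⊥-stable (proj₁ x) ⊆Δ ⊢⊥
    }

  canonical : CS4Model
  canonical = record
    { model = record
      { frame      = frame
      ; V          = λ p x → World x × (⟦ proj₁ x ⟧ ⊢ var p)
      ; V-≼-closed = λ where
          p refl            h        → h
          p [ _ , y , Γ⊆Δ ] (_ , ⊢p) → y , ⊆⇒⊢ Γ⊆Δ ⊢p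
      ; W⊥⊆V       = λ p (x , ⊢⊥) → x , mp (ax ⊥-E) ⊢⊥
      }
    ; isCS4Frame = ⊑-backwardConfluent
    }

  open CS4Model canonical using (model)

  canonical-finite : Finite W
  canonical-finite = ×-finite (Subset-finite n)

  ≼⇒⊆ : ∀ {x y} → World x → x ≼ y → World y × proj₁ x ⊆ proj₁ y
  ≼⇒⊆ x refl            = x , id
  ≼⇒⊆ _ [ _ , y , Γ⊆Δ ] = y , Γ⊆Δ

  ⊑⇒∩stables⊆ : ∀ {x y} → World x → x ⊑ y → World y × proj₁ x ∩ stables ⊆ proj₁ y
  ⊑⇒∩stables⊆ {Γ , _} x refl = x , proj₁ ∘ x∈p∩q⁻ Γ stables
  ⊑⇒∩stables⊆ _ [ _ , y , ⊆Δ , _ ] = y , ⊆Δ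

  ⊑⇒promise : ∀ {x y} → x ⊑ y → ∀ {i} → proj₂ x ≡ suc i → proj₂ y ≡ suc i
  ⊑⇒promise refl              = id
  ⊑⇒promise [ _ , _ , _ , d ] = d

  -- The truth lemma.

  module TruthLemma (decide : ∀ Γ i → Dec (⟦ Γ ⟧ ⊢ F i) × Dec (⟦ Γ ⟧ ⊢ ◇ F i)) where

    ⇒-witness : ∀ Γ {A B} → Listed F A → Listed F B →
                (⟦ Γ ⟧ ⊢ A ⇒ B) ⊎ (Σ[ Δ ∈ Subset n ] Γ ⊆ Δ × Prime Δ × (⟦ Δ ⟧ ⊢ A) × ¬ (⟦ Δ ⟧ ⊢ B))
    ⇒-witness Γ (a , refl) (b , refl) with proj₁ (decide (Γ ∪ ⁅ a ⁆) b)
    ... | yes ⊢B = inj₁ (∪-deduction Γ a ⊢B)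
    ... | no  ⊬B =
      let Δ , ⊆Δ , Δ-prime , Δ⊬B = lindenbaum (λ Θ → proj₁ (decide Θ b)) (Γ ∪ ⁅ a ⁆) ⊬B
      in  inj₂ (Δ , ⊆Δ ∘ p⊆p∪q _ , Δ-prime , ∈⇒⊢ (⊆Δ (q⊆p∪q Γ _ (x∈⁅x⁆ a))) , Δ⊬B)

    □-witness : ∀ Γ {A} → Listed F A →
                (⟦ Γ ⟧ ⊢ □ A) ⊎ (Σ[ Δ ∈ Subset n ] Γ ∩ stables ⊆ Δ × Prime Δ × ¬ (⟦ Δ ⟧ ⊢ A))
    □-witness Γ (a , refl) with proj₁ (decide (Γ ∩ stables) a)
    ... | yes ⊢A = inj₁ (∩stables-nec Γ ⊢A)
    ... | no  ⊬A = inj₂ (lindenbaum (λ Θ → proj₁ (decide Θ a)) (Γ ∩ stables) ⊬A)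

    ◇-witness : ∀ {Γ d A} → Listed F A → World (Γ , d) → ⟦ Γ ⟧ ⊢ ◇ A →
                Σ[ Δ ∈ Subset n ] Γ ∩ stables ⊆ Δ × World (Δ , d) × (⟦ Δ ⟧ ⊢ A)
    ◇-witness {d = zero} _ _ _ = full , ⊆⊤ , (full-prime , λ ()) , full-⊢
    ◇-witness {Γ} {suc i} (a , refl) (_ , keeps) ⊢◇A
      with proj₂ (decide ((Γ ∩ stables) ∪ ⁅ a ⁆) i)
    -- Boxing `F a ⇒ ◇ F i` and applying `K◇` to `◇ F a` gives `◇ ◇ F i`; `4◇` collapses it to
    -- `◇ F i`, against the promise.
    ... | yes ⊢◇Fi = contradiction
      (mp (thm 4◇) (mp (mp (thm K◇) (∩stables-nec Γ (∪-deduction (Γ ∩ stables) a ⊢◇Fi))) ⊢◇A))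
      (keeps refl)
    ... | no  ⊬◇Fi =
      let Δ , ⊆Δ , Δ-prime , Δ⊬◇Fi = lindenbaum (λ Θ → proj₂ (decide Θ i)) ((Γ ∩ stables) ∪ ⁅ a ⁆) ⊬◇Fi
      in  Δ , ⊆Δ ∘ p⊆p∪q _ , (Δ-prime , λ { refl → Δ⊬◇Fi }) , ∈⇒⊢ (⊆Δ (q⊆p∪q (Γ ∩ stables) _ (x∈⁅x⁆ a)))

    ◇-promise : ∀ {Γ A} → Listed F A → Prime Γ →
                (⟦ Γ ⟧ ⊢ ◇ A) ⊎ (∃ λ i → F i ≡ A × World (Γ , suc i))
    ◇-promise {Γ} (a , refl) Γ-prime with proj₂ (decide Γ a)
    ... | yes ⊢◇A = inj₁ ⊢◇A
    ... | no  ⊬◇A = inj₂ (a , refl , Γ-prime , λ { refl → ⊬◇A })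

    -- Both directions go by mutual induction on `χ`, because the antecedent of an implication swaps
    -- them.
    ⊢⇒⊨ : ∀ χ → All (Listed F) (subformulas χ) → ∀ {x} → World x → ⟦ proj₁ x ⟧ ⊢ χ → ⟨ model , x ⟩⊨ χ
    ⊨⇒⊢ : ∀ χ → All (Listed F) (subformulas χ) → ∀ {x} → World x → ⟨ model , x ⟩⊨ χ → ⟦ proj₁ x ⟧ ⊢ χ

    ⊢⇒⊨ (var p) _ x ⊢p = x , ⊢p
    ⊢⇒⊨ ⊥′      _ x ⊢⊥ = x , ⊢⊥
    ⊢⇒⊨ (A ∧ B) (_ ∷ ls) x ⊢A∧B =
      ⊢⇒⊨ A (++⁻ˡ _ ls) x (mp (ax ∧-E₁) ⊢A∧B) , ⊢⇒⊨ B (++⁻ʳ (subformulas A) ls) x (mp (ax ∧-E₂) ⊢A∧B)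
    ⊢⇒⊨ (A ∨ B) (_ ∷ ls) x@(Γ-prime , _) ⊢A∨B =
      Sum.map (⊢⇒⊨ A lsA x) (⊢⇒⊨ B lsB x) (prime-∨ (head lsA) (head lsB) Γ-prime ⊢A∨B)
      where
      lsA = ++⁻ˡ _ ls
      lsB = ++⁻ʳ (subformulas A) ls
    ⊢⇒⊨ (A ⇒ B) (_ ∷ ls) x ⊢A⇒B _ x≼y ⊨A =
      let y , Γ⊆Δ = ≼⇒⊆ x x≼y
      in  ⊢⇒⊨ B (++⁻ʳ (subformulas A) ls) y (mp (⊆⇒⊢ Γ⊆Δ ⊢A⇒B) (⊨⇒⊢ A (++⁻ˡ _ ls) y ⊨A))
    ⊢⇒⊨ (◇ A) (_ ∷ ls) x ⊢◇A (_ , d) x≼y =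
      let y , Γ⊆Δ = ≼⇒⊆ x x≼y
          Θ , ⊆Θ , z , ⊢A = ◇-witness (head ls) y (⊆⇒⊢ Γ⊆Δ ⊢◇A)
      in  (Θ , d) , [ y , z , ⊆Θ , id ] , ⊢⇒⊨ A ls z ⊢A
    ⊢⇒⊨ (□ A) (l ∷ ls) x ⊢□A _ _ x≼y y⊑z =
      let y , Γ⊆Δ = ≼⇒⊆ x x≼y
          z , ⊆Θ  = ⊑⇒∩stables⊆ y y⊑z
      in  ⊢⇒⊨ A ls z (mp (thm T□) (stable-transfer l □-stable (proj₁ y) ⊆Θ (⊆⇒⊢ Γ⊆Δ ⊢□A)))

    ⊨⇒⊢ (var p) _ _ (_ , ⊢p) = ⊢p
    ⊨⇒⊢ ⊥′      _ _ (_ , ⊢⊥) = ⊢⊥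
    ⊨⇒⊢ (A ∧ B) (_ ∷ ls) x (⊨A , ⊨B) =
      mp (mp (ax ∧-I) (⊨⇒⊢ A (++⁻ˡ _ ls) x ⊨A)) (⊨⇒⊢ B (++⁻ʳ (subformulas A) ls) x ⊨B)
    ⊨⇒⊢ (A ∨ B) (_ ∷ ls) x (inj₁ ⊨A) = mp (ax ∨-I₁) (⊨⇒⊢ A (++⁻ˡ _ ls) x ⊨A)
    ⊨⇒⊢ (A ∨ B) (_ ∷ ls) x (inj₂ ⊨B) = mp (ax ∨-I₂) (⊨⇒⊢ B (++⁻ʳ (subformulas A) ls) x ⊨B)
    ⊨⇒⊢ (A ⇒ B) (_ ∷ ls) {Γ , _} x ⊨A⇒B
      with ⇒-witness Γ (head (++⁻ˡ (subformulas A) ls)) (head (++⁻ʳ (subformulas A) ls))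
    ... | inj₁ ⊢A⇒B = ⊢A⇒B
    ... | inj₂ (Δ , Γ⊆Δ , Δ-prime , ⊢A , ⊬B) = contradiction
      (⊨⇒⊢ B (++⁻ʳ (subformulas A) ls) y
        (⊨A⇒B (Δ , zero) [ x , y , Γ⊆Δ ] (⊢⇒⊨ A (++⁻ˡ _ ls) y ⊢A)))
      ⊬B
      where
      y : World (Δ , zero)
      y = Δ-prime , λ ()
    ⊨⇒⊢ (◇ A) (_ ∷ ls) {Γ , _} x ⊨◇A with ◇-promise (head ls) (proj₁ x)
    ... | inj₁ ⊢◇A = ⊢◇A
    ... | inj₂ (i , Fi≡A , y) =
      -- `◇ A` is evaluated at the same theory with `A` promised: the successor inherits the
      -- promise, so it cannot derive `A` by `T◇`.
      let (Θ , _) , y⊑z , ⊨A = ⊨◇A (Γ , suc i) [ x , y , id ]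
          z , _ = ⊑⇒∩stables⊆ y y⊑z
          ⊢Fi = subst (⟦ Θ ⟧ ⊢_) (sym Fi≡A) (⊨⇒⊢ A ls z ⊨A)
      in  contradiction (mp (thm T◇) ⊢Fi) (proj₂ z (⊑⇒promise y⊑z refl))
    ⊨⇒⊢ (□ A) (_ ∷ ls) {Γ , _} x ⊨□A with □-witness Γ (head ls)
    ... | inj₁ ⊢□A = ⊢□A
    ... | inj₂ (Δ , ⊆Δ , Δ-prime , ⊬A) = contradiction
      -- The promise of the given world might fail at `Δ`; passing first to `(Γ , zero)` along `≼`
      -- discards it.
      (⊨⇒⊢ A ls z (⊨□A (Γ , zero) (Δ , zero) [ x , y , id ] [ y , z , ⊆Δ , (λ ()) ]))
      ⊬A
      where
      y : World (Γ , zero)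
      y = proj₁ x , λ ()
      z : World (Δ , zero)
      z = Δ-prime , λ ()

  canonical-refutes : ∀ φ → All (Listed F) (subformulas φ) → ¬ (CS4⊢ φ) → ¬ (model ⊨ φ)
  canonical-refutes φ ls ⊬φ ⊨φ =
    ¬¬-finite-∀ (×-finite (Subset-finite n))
      (λ _ ¬both → ¬¬-excluded-middle λ ⊢? → ¬¬-excluded-middle λ ⊢◇? → ¬both (⊢? , ⊢◇?))
      (refute ∘ λ decide Γ i → decide (Γ , i))
    where
    ∅⊬φ : ¬ (⟦ ∅ ⟧ ⊢ φ)
    ∅⊬φ = ⊬φ ∘ ⊢-closed λ _ (_ , i∈∅ , _) → ∉⊥ i∈∅

    refute : ¬ (∀ Γ i → Dec (⟦ Γ ⟧ ⊢ F i) × Dec (⟦ Γ ⟧ ⊢ ◇ F i))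
    refute decide =
      let i , Fi≡φ = head ls
          Γ , _ , Γ-prime , Γ⊬φ =
            -- Starting from `∅` is possible because derivations from it are theorems.
            lindenbaum (λ Γ → subst (λ χ → Dec (⟦ Γ ⟧ ⊢ χ)) Fi≡φ (proj₁ (decide Γ i))) ∅ ∅⊬φ
          x = Γ-prime , λ ()
      in  Γ⊬φ (⊨⇒⊢ φ ls x (⊨φ (Γ , zero) λ (_ , ⊢⊥) → Γ⊬φ (mp (ax ⊥-E) ⊢⊥)))
      where open TruthLemma decide

∈⇒Listed : ∀ {Σ χ} → χ ∈ₗ Σ → Listed (lookup Σ) χ
∈⇒Listed χ∈Σ = index χ∈Σ , sym (lookup-index χ∈Σ)

mainTheorem1 : (∀ (φ : Formula) → ¬ (CS4⊢ φ) →
    Σ[ M ∈ CS4Model ] (Finite (CS4Model.W M) × ¬ (CS4Model.model M ⊨ φ)))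
    × (∀ (φ : Formula) → CS4⊢ φ → ∀ (M : CS4Model) → CS4Model.model M ⊨ φ)
mainTheorem1 = finite-countermodel , λ φ ⊢φ M w _ → Soundness.CS4-sound M ⊢φ w
  where
  finite-countermodel : ∀ φ → ¬ (CS4⊢ φ) →
    Σ[ M ∈ CS4Model ] (Finite (CS4Model.W M) × ¬ (CS4Model.model M ⊨ φ))
  finite-countermodel φ ⊬φ =
    -- `⊥′` is put in front since it may not occur in `φ`, yet fallibility must transfer along `⊑`;
    -- `there` skips this entry.
    canonical , canonical-finite , canonical-refutes φ (tabulate (∈⇒Listed ∘ there)) ⊬φ
    where open Canonical (lookup (⊥′ ∷ subformulas φ)) (∈⇒Listed (here refl))
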